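{- Let $X$ be a homogeneously self-similar graph (not assumed locally finite) with constant inner degree. Then one of the following statements is true: (i) The graph $X$ has bounded geometry. (ii) There exists no origin vertex, and $X$ is locally finite but has unbounded geometry. (iii) There exists an origin vertex and $X$ is non-locally finite.
   Context: Graph $X$ with vertex set $VX$ and edge set $EX$ is connected, infinite, without loops or multiple edges; vertices may have infinite degree. $d_X$ is the graph distance and $\deg_X x$ the number of neighbours of $x$ in $X$. $X$ is locally finite if all vertex degrees are finite. For $C\subset VX$, the boundary $\theta C$ is the set of vertices in $VX\setminus C$ adjacent to some vertex of $C$; the closure is $\overline{C}=C\cup\theta C$; $\hat C$ is the subgraph of $X$ spanned (induced) by $\overline{C}$. For $F\subset VX$, $\mathcal{C}_XF$ denotes the set of connected components of $VX\setminus F$ (as vertex sets). The reduced graph $X_F$ has vertex set $F$, and two (distinct) vertices $x,y\in F$ are adjacent in $X_F$ iff there is $C\in\mathcal{C}_XF$ with $x,y\in\theta C$. $X$ is self-similar with respect to $F\subset VX$ and $\psi:VX\to F$ if: (F1) no two vertices of $F$ are adjacent in $X$; (F2) the intersection of the closures of two different components in $\mathcal{C}_XF$ contains at most one vertex; (F3) $\psi$ is a graph isomorphism from $X$ to $X_F$. Elements of $\mathcal{C}_XF$ are called cells. An origin vertex is a fixed point of $\psi$. A self-similar graph $X$ is homogeneously self-similar if: (H1) all cell graphs $\hat C$ ($C\in\mathcal{C}_XF$) are finite and for any cells $C,D$ there is a graph isomorphism $\alpha:\hat C\to\hat D$ with $\alpha(\theta C)=\theta D$; (H2) for every cell $C$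 and $v_1,v_2,v_3,v_4\in\theta C$ with $v_1\neq v_2$, $v_3\ne v_4$, one has $d_X(v_1,v_2)=d_X(v_3,v_4)$. $X$ has bounded geometry if the set of its vertex degrees is bounded (by a finite number), and unbounded geometry otherwise. $X$ has constant inner degree if there is a number $b$ with $b=\deg_{\hat C}v$ for every cell $C$ and every $v\in\theta C$. -}

module Defs where

open import Data.Fin using (Fin)
open import Data.Nat using (ℕ; suc; _≤_)
open import Data.Product using (∃-syntax; Σ-syntax; _×_; _,_)
open import Data.Refinement using (Refinement-syntax; value)
open import Function.Bundles using (_↔_; _⇔_)
open import Function.Definitions using (Bijective)
open import Level using (Level; _⊔_) renaming (suc to lsuc)
open import Relation.Binary.Construct.Closure.ReflexiveTransitive using (Star)
open import Relation.Binary.Core using (Rel)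
open import Relation.Binary.Definitions using (Irreflexive; Symmetric)
open import Relation.Binary.PropositionalEquality using (_≡_; _≢_; refl; sym)
open import Relation.Nullary using (¬_)
open import Relation.Unary using (Pred; _∈_; _∉_; _∪_; ∁; _≐_)

private
  variable
    a b p v e f v′ e′ : Level

HasCardinality : Set a → ℕ → Set a
HasCardinality A n = Fin n ↔ A

Finite : Set a → Set a
Finite A = ∃[ n ] HasCardinality A n

image : {A : Set a} {B : Set b} → (A → B) → Pred A p → Pred B (a ⊔ b ⊔ p)
image g P y = ∃[ x ] (x ∈ P × g x ≡ y)

-- Vertex equality is propositional equality.  Vertex sets of subgraphs are
-- refinement types, whose membership proofs are irrelevant, so that two
-- vertices of a subgraph are equal exactly when their values are.
record Graph v e : Set (lsuc (v ⊔ e)) where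
  infix 4 _~_
  field
    Vertex   : Set v
    _~_      : Rel Vertex e
    ~-sym    : Symmetric _~_
    ~-irrefl : Irreflexive _≡_ _~_

open Graph using (Vertex)

module _ (X : Graph v e) where
  open Graph X using (_~_; ~-sym; ~-irrefl)

  Connected : Set (v ⊔ e)
  Connected = ∀ x y → Star _~_ x y

  component : Vertex X → Pred (Vertex X) (v ⊔ e)
  component x = Star _~_ x

  data Walk : ℕ → Vertex X → Vertex X → Set (v ⊔ e) where
    []  : ∀ {x} → Walk 0 x x
    _∷_ : ∀ {n x y z} → x ~ y → Walk n y z → Walk (suc n) x z

  -- The distance of x and y is n.
  IsDistance : Vertex X → Vertex X → ℕ → Set (v ⊔ e)
  IsDistance x y n = Walk n x y × (∀ m → Walk m x y → n ≤ m)

  -- A proof of x ~ y carries no information here: the cardinality counts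
  -- neighbours, not proofs of adjacency.
  HasDegree : Vertex X → ℕ → Set (v ⊔ e)
  HasDegree x n = HasCardinality [ y ∈ Vertex X ∣ x ~ y ] n

  LocallyFinite : Set (v ⊔ e)
  LocallyFinite = ∀ x → ∃[ n ] HasDegree x n

  BoundedGeometry : Set (v ⊔ e)
  BoundedGeometry = ∃[ N ] (∀ x → ∃[ n ] (n ≤ N × HasDegree x n))

  θ : Pred (Vertex X) p → Pred (Vertex X) (v ⊔ e ⊔ p)
  θ C x = x ∉ C × ∃[ y ] (y ∈ C × x ~ y)

  closure : Pred (Vertex X) p → Pred (Vertex X) (v ⊔ e ⊔ p)
  closure C = C ∪ θ C

  spanned : Pred (Vertex X) p → Graph (v ⊔ p) e
  spanned P = record
    { Vertex   = [ x ∈ Vertex X ∣ P x ]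
    ; _~_      = λ x y → value x ~ value y
    ; ~-sym    = ~-sym
    ; ~-irrefl = λ { refl → ~-irrefl refl }
    }

record IsIsomorphism (G : Graph v e) (H : Graph v′ e′)
                     (φ : Vertex G → Vertex H) : Set (v ⊔ e ⊔ v′ ⊔ e′) where
  private
    module G = Graph G
    module H = Graph H
  field
    bijective : Bijective _≡_ _≡_ φ
    adjacency : ∀ x y → (x G.~ y) ⇔ (φ x H.~ φ y)

module _ (X : Graph v e) (F : Pred (Vertex X) f) where
  open Graph X using (_~_)

  -- A cell is named by any one of its vertices.  Hence two names denote the
  -- same cell when their vertex sets coincide (_≐_), not when they are equal.
  Cell : Set (v ⊔ f)
  Cell = Vertex (spanned X (∁ F))

  ⟦_⟧ : Cell → Pred (Vertex X) (v ⊔ e ⊔ f)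
  ⟦ C ⟧ = image value (component (spanned X (∁ F)) C)

  cellGraph : Cell → Graph (v ⊔ e ⊔ f) e
  cellGraph C = spanned X (closure X ⟦ C ⟧)

  reducedGraph : Graph (v ⊔ f) (v ⊔ e ⊔ f)
  reducedGraph = record
    { Vertex   = [ x ∈ Vertex X ∣ F x ]
    ; _~_      = λ x y → x ≢ y × Σ[ C ∈ Cell ] (value x ∈ θ X ⟦ C ⟧ × value y ∈ θ X ⟦ C ⟧)
    ; ~-sym    = λ { (x≢y , C , x∈θC , y∈θC) → (λ y≡x → x≢y (sym y≡x)) , C , y∈θC , x∈θC }
    ; ~-irrefl = λ { x≡y (x≢y , _) → x≢y x≡y }
    }

  record SelfSimilar (ψ : Vertex X → [ x ∈ Vertex X ∣ F x ]) : Set (v ⊔ e ⊔ f) where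
    field
      F1 : ∀ x y → x ∈ F → y ∈ F → ¬ (x ~ y)
      F2 : ∀ C D → ¬ (⟦ C ⟧ ≐ ⟦ D ⟧) →
           ∀ x y → x ∈ closure X ⟦ C ⟧ → x ∈ closure X ⟦ D ⟧ →
                   y ∈ closure X ⟦ C ⟧ → y ∈ closure X ⟦ D ⟧ → x ≡ y
      F3 : IsIsomorphism X reducedGraph ψ

  record HomogeneouslySelfSimilar (ψ : Vertex X → [ x ∈ Vertex X ∣ F x ]) : Set (v ⊔ e ⊔ f) where
    field
      selfSimilar : SelfSimilar ψ
      H1-finite   : ∀ C → Finite (Vertex (cellGraph C))
      H1-iso      : ∀ C D → ∃[ α ] (IsIsomorphism (cellGraph C) (cellGraph D) α ×
                    image (λ x → value (α x)) (λ x → value x ∈ θ X ⟦ C ⟧) ≐ θ X ⟦ D ⟧)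
      H2          : ∀ C v₁ v₂ v₃ v₄ →
                    v₁ ∈ θ X ⟦ C ⟧ → v₂ ∈ θ X ⟦ C ⟧ → v₃ ∈ θ X ⟦ C ⟧ → v₄ ∈ θ X ⟦ C ⟧ →
                    v₁ ≢ v₂ → v₃ ≢ v₄ →
                    ∀ m n → IsDistance X v₁ v₂ m → IsDistance X v₃ v₄ n → m ≡ n

  ConstantInnerDegree : Set (v ⊔ e ⊔ f)
  ConstantInnerDegree =
    ∃[ b ] (∀ C (x : Vertex (cellGraph C)) → value x ∈ θ X ⟦ C ⟧ → HasDegree (cellGraph C) x b)

  IsOrigin : (Vertex X → [ x ∈ Vertex X ∣ F x ]) → Pred (Vertex X) v
  IsOrigin ψ x = value (ψ x) ≡ x

{-# OPTIONS --safe #-}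
module Submission where

-- Let t be the common size of the cell boundaries and b the inner degree.  Around ψ x every
-- cell contributes b neighbours in X, and by (F2) t − 1 neighbours of its own in the reduced
-- graph; hence deg (ψ x) · (t − 1) = deg x · b.  Cells are finite of one size, so degrees
-- outside F are bounded.  A walk between two vertices of F is at least twice as long as some
-- walk between their preimages, so by connectedness at most one vertex lies in all iterated
-- images of ψ, and it is then an origin.  Every other vertex is an iterated image of a vertex
-- outside F: without an origin all degrees are finite, while at an origin of finite degree the
-- equation forces b = t − 1, so that ψ preserves degrees and they are bounded.

open import Algebra.Properties.CommutativeSemigroup using (x∙yz≈y∙xz)
open import Axiom.ExcludedMiddle using (ExcludedMiddle)
open import Data.Bool using (true; false)
open import Data.Empty using (⊥-elim-irr)
open import Data.Fin using (Fin; zero; suc)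
open import Data.Irrelevant using ([_])
open import Data.List using (List; []; _∷_; _++_; length; map; filter; lookup; tabulate; deduplicate)
open import Data.List.Membership.Propositional using () renaming (_∈_ to _∈ˡ_)
open import Data.List.Membership.Propositional.Properties
  using (∈-map⁺; ∈-map⁻; ∈-filter⁺; ∈-filter⁻; ∈-tabulate⁺; ∈-lookup; ∈-deduplicate⁺;
         ∈-++⁺ˡ; ∈-++⁺ʳ)
open import Data.List.Membership.Propositional.Properties.WithK using (unique∧set⇒bag)
open import Data.List.Properties using (length-map; length-filter; length-tabulate)
open import Data.List.Relation.Binary.BagAndSetEquality using (∼bag⇒↭)
open import Data.List.Relation.Binary.Permutation.Propositional.Properties using (↭-length)
open import Data.List.Relation.Unary.All as All using (All; []; _∷_)
open import Data.List.Relation.Unary.Any using (here; there; index)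
open import Data.List.Relation.Unary.Any.Properties using (lookup-index)
open import Data.List.Relation.Unary.Unique.Propositional using (Unique; []; _∷_)
import Data.List.Relation.Unary.Unique.Propositional.Properties as Unique
open import Data.List.Relation.Unary.Unique.DecPropositional.Properties using (deduplicate-!)
open import Data.Nat using (ℕ; zero; suc; _+_; _*_; _≤_; z≤n; s≤s) renaming (_⊔_ to _⊔ⁿ_)
open import Data.Nat.GeneralisedArithmetic using (fold)
open import Data.Nat.ListAction using (sum)
open import Data.Nat.Properties
  using (+-suc; +-commutativeSemigroup; *-cancelˡ-≡; *-cancelʳ-≡; ≤-refl; ≤-reflexive; ≤-trans;
         m≤n⇒m≤1+n; m≤n+m; m≤m⊔n; m≤n⊔m)
open import Data.Product using (∃-syntax; _×_; _,_; proj₁; proj₂)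
open import Data.Refinement using (Refinement-syntax; value; value-injective; _,_)
open import Data.Sum using (_⊎_; inj₁; inj₂)
open import Function using (_∘_; id)
open import Function.Bundles using (mk⇔; mk↔ₛ′; module Inverse; module Equivalence)
open import Function.Definitions using (Injective)
open import Level using (Level; _⊔_; Lift; lift; lower)
open import Relation.Binary.Construct.Closure.ReflexiveTransitive using (Star; ε; _◅_; _◅◅_; reverse)
open import Relation.Binary.Definitions using (DecidableEquality)
open import Relation.Binary.PropositionalEquality
open import Relation.Nullary using (¬_; Dec; yes; no; does; contradiction; recompute; ¬?)
open import Relation.Nullary.Decidable using (map′)
open import Relation.Unary using (Pred; Decidable; _∈_; _∉_; _⊆_; _≐_; U)
open import Defs

private
  variable
    a a′ ℓ ℓ′ ℓ″ : Level

-- Decidability and lists without repetition.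

excludedMiddle-lower : ∀ a a′ → ExcludedMiddle (a ⊔ a′) → ExcludedMiddle a
excludedMiddle-lower a a′ em = map′ lower lift (em {Lift (a ⊔ a′) _})

-- The membership proof stored in a refinement is irrelevant; a decision procedure turns it back
-- into one that can be analysed.
proof-of : {A : Set a} {P : Pred A ℓ} → Decidable P → (x : [ x ∈ A ∣ P x ]) → P (value x)
proof-of P? (x , [ Px ]) = recompute (P? x) Px

lookup-injective : {A : Set a} {xs : List A} → Unique xs → ∀ i j → lookup xs i ≡ lookup xs j → i ≡ j
lookup-injective (_   ∷ _) zero    zero    _  = refl
lookup-injective (x≢  ∷ _) zero    (suc j) eq = contradiction eq (All.lookup x≢ (∈-lookup j))
lookup-injective (x≢  ∷ _) (suc i) zero    eq = contradiction (sym eq) (All.lookup x≢ (∈-lookup i))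
lookup-injective (_   ∷ u) (suc i) (suc j) eq = cong suc (lookup-injective u i j eq)

-- Double counting over lists.

module _ {A : Set a} {B : Set a′} {R : A → B → Set ℓ″} (R? : ∀ x y → Dec (R x y)) where

  row : List B → A → ℕ
  row ys x = length (filter (R? x) ys)

  column : List A → B → ℕ
  column xs y = length (filter (λ x → R? x y) xs)

  -- A new entry `x` raises the column of `y` by one exactly when `R x y` holds, and these
  -- increments add up to the row of `x`.
  sum-column-∷ : ∀ x xs ys → sum (map (column (x ∷ xs)) ys) ≡ row ys x + sum (map (column xs) ys)
  sum-column-∷ x xs []       = refl
  sum-column-∷ x xs (y ∷ ys) with does (R? x y)
  ... | true  = cong suc (trans (cong (column xs y +_) (sum-column-∷ x xs ys))
                  (x∙yz≈y∙xz +-commutativeSemigroup (column xs y) (row ys x) (sum (map (column xs) ys))))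
  ... | false = trans (cong (column xs y +_) (sum-column-∷ x xs ys))
                  (x∙yz≈y∙xz +-commutativeSemigroup (column xs y) (row ys x) (sum (map (column xs) ys)))

  double-counting : ∀ xs ys → sum (map (row ys) xs) ≡ sum (map (column xs) ys)
  double-counting []       []       = refl
  double-counting []       (y ∷ ys) = double-counting [] ys
  double-counting (x ∷ xs) ys       =
    trans (cong (row ys x +_) (double-counting xs ys)) (sym (sum-column-∷ x xs ys))

sum-constant : {A : Set a} {g : A → ℕ} {k : ℕ} {xs : List A} →
               All (λ x → g x ≡ k) xs → sum (map g xs) ≡ length xs * k
sum-constant []         = refl
sum-constant (eq ∷ eqs) = cong₂ _+_ eq (sum-constant eqs)

-- Counting the elements of a predicate.

record Enumeration {A : Set a} (P : Pred A ℓ) (n : ℕ) : Set (a ⊔ ℓ) where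
  field
    -- The entries come from `A` itself rather than from a refinement of it, so membership proofs
    -- stay relevant and counting reduces to operations on lists.
    list     : List A
    unique   : Unique list
    sound    : ∀ {x} → x ∈ˡ list → x ∈ P
    complete : ∀ {x} → x ∈ P → x ∈ˡ list
    size     : length list ≡ n

open Enumeration

module _ {A : Set a} {P : Pred A ℓ} where

  -- Lists without repetition that have the same members are equal as bags, hence permutations of
  -- each other.
  enumeration-unique : ∀ {n m} → Enumeration P n → Enumeration P m → n ≡ m
  enumeration-unique E E′ = begin
    _                 ≡⟨ size E ⟨
    length (list E)   ≡⟨ ↭-length (∼bag⇒↭ (unique∧set⇒bag (unique E) (unique E′) λ {_} →
                           mk⇔ (complete E′ ∘ sound E) (complete E ∘ sound E′))) ⟩
    length (list E′)  ≡⟨ size E′ ⟩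
    _                 ∎
    where open ≡-Reasoning

  enumeration-resp : ∀ {Q : Pred A ℓ′} {n} → P ⊆ Q → Q ⊆ P → Enumeration P n → Enumeration Q n
  enumeration-resp P⊆Q Q⊆P E = record
    { list     = list E
    ; unique   = unique E
    ; sound    = P⊆Q ∘ sound E
    ; complete = complete E ∘ Q⊆P
    ; size     = size E
    }

  enumeration-image : ∀ {B : Set a′} {g : A → B} {n} → Injective _≡_ _≡_ g →
                      Enumeration P n → Enumeration (image g P) n
  enumeration-image {g = g} g-inj E = record
    { list     = map g (list E)
    ; unique   = Unique.map⁺ g-inj (unique E)
    ; sound    = λ y∈ → let x , x∈ , y≡gx = ∈-map⁻ g y∈ in x , sound E x∈ , sym y≡gx
    ; complete = λ { (x , Px , refl) → ∈-map⁺ g (complete E Px) }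
    ; size     = trans (length-map g (list E)) (size E)
    }

  enumeration-filter : ∀ {Q : Pred A ℓ′} {n} (Q? : Decidable Q) (E : Enumeration P n) →
                       Enumeration (λ x → x ∈ P × x ∈ Q) (length (filter Q? (list E)))
  enumeration-filter Q? E = record
    { list     = filter Q? (list E)
    ; unique   = Unique.filter⁺ Q? (unique E)
    ; sound    = λ x∈ → let x∈E , Qx = ∈-filter⁻ Q? {xs = list E} x∈ in sound E x∈E , Qx
    ; complete = λ (Px , Qx) → ∈-filter⁺ Q? (complete E Px) Qx
    ; size     = refl
    }

enumeration-sub : {A : Set a} {P : Pred A ℓ} {Q : Pred A ℓ′} {n : ℕ} → Decidable P → P ⊆ Q →
                  Enumeration Q n → ∃[ m ] (m ≤ n × Enumeration P m)
enumeration-sub P? P⊆Q E =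
  _ , subst (_ ≤_) (size E) (length-filter P? (list E))
  , enumeration-resp proj₂ (λ Px → P⊆Q Px , Px) (enumeration-filter P? E)

module _ {A : Set a} {P : Pred A ℓ} where

  enumeration-cover : DecidableEquality A → Decidable P → (xs : List A) →
                      (∀ {x} → x ∈ P → x ∈ˡ xs) → ∃[ n ] Enumeration P n
  enumeration-cover _≟_ P? xs P⊆xs =
    let n , _ , E = enumeration-sub P? (∈-deduplicate⁺ _≟_ ∘ P⊆xs) deduplicated in n , E
    where
    deduplicated : Enumeration (_∈ˡ deduplicate _≟_ xs) (length (deduplicate _≟_ xs))
    deduplicated = record
      { list     = deduplicate _≟_ xs
      ; unique   = deduplicate-! _≟_ xs
      ; sound    = id
      ; complete = id
      ; size     = refl
      }

  -- Putting `x` back in front of the filtered list enumerates `P` again, so filtering has cost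
  -- exactly one element.
  enumeration-remove : DecidableEquality A → ∀ {x n} → x ∈ P → Enumeration P n →
                       ∃[ m ] (n ≡ suc m × Enumeration (λ y → y ∈ P × y ≢ x) m)
  enumeration-remove _≟_ {x} Px E = _ , enumeration-unique E E⁺ , E⁻
    where
    E⁻ = enumeration-filter (λ y → ¬? (y ≟ x)) E
    E⁺ : Enumeration P (suc (length (list E⁻)))
    E⁺ = record
      { list     = x ∷ list E⁻
      ; unique   = All.tabulate (λ y∈ x≡y → proj₂ (sound E⁻ y∈) (sym x≡y)) ∷ unique E⁻
      ; sound    = λ { (here refl) → Px ; (there y∈) → proj₁ (sound E⁻ y∈) }
      ; complete = complete⁺
      ; size     = refl
      }
      where
      complete⁺ : ∀ {y} → y ∈ P → y ∈ˡ (x ∷ list E⁻)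
      complete⁺ {y} Py with y ≟ x
      ... | yes refl = here refl
      ... | no y≢x   = there (complete E⁻ (Py , y≢x))

  enumeration-member : ∀ {n} → Enumeration P (suc n) → ∃[ x ] x ∈ P
  enumeration-member E with list E in eq | size E
  ... | x ∷ xs | _ = x , sound E (subst (x ∈ˡ_) (sym eq) (here refl))

  cardinality⇐ : ∀ {n} → DecidableEquality A → Enumeration P n → HasCardinality [ x ∈ A ∣ P x ] n
  cardinality⇐ _≟_ E = subst (HasCardinality _) (size E) (mk↔ₛ′ to from to-from from-to)
    where
    open import Data.List.Membership.DecPropositional _≟_ using (_∈?_)
    position : (x : [ x ∈ A ∣ P x ]) → value x ∈ˡ list E
    -- `Px` is irrelevant, but the type of positions in the list is not; deciding membership in the
    -- list bridges the gap.
    position (x , [ Px ]) = recompute (x ∈? list E) (complete E Px)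
    to : Fin (length (list E)) → [ x ∈ A ∣ P x ]
    to i = lookup (list E) i , [ sound E (∈-lookup i) ]
    from : [ x ∈ A ∣ P x ] → Fin (length (list E))
    from x = index (position x)
    to-from : ∀ x → to (from x) ≡ x
    to-from x = value-injective (sym (lookup-index (position x)))
    from-to : ∀ i → from (to i) ≡ i
    from-to i = lookup-injective (unique E) _ _ (sym (lookup-index (position (to i))))

enumeration-U : {A : Set a} {n : ℕ} → HasCardinality A n → Enumeration {A = A} U n
enumeration-U A↔ = record
  { list     = tabulate to
  ; unique   = Unique.tabulate⁺ λ {i} {j} eq →
                 trans (sym (strictlyInverseʳ i)) (trans (cong from eq) (strictlyInverseʳ j))
  ; sound    = λ _ → _
  ; complete = λ {x} _ → subst (_∈ˡ tabulate to) (strictlyInverseˡ x) (∈-tabulate⁺ (from x))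
  ; size     = length-tabulate to
  }
  where open Inverse A↔

cardinality⇒ : {A : Set a} {P : Pred A ℓ} {n : ℕ} → Decidable P →
               HasCardinality [ x ∈ A ∣ P x ] n → Enumeration P n
cardinality⇒ P? c = enumeration-resp
  (λ { (x , _ , refl) → proof-of P? x }) (λ {x} Px → (x , [ Px ]) , _ , refl)
  (enumeration-image value-injective (enumeration-U c))

module _ {A : Set a} {B : Set a′} {P : Pred A ℓ} {Q : Pred B ℓ′} {R : A → B → Set ℓ″} where

  -- Both products count the related pairs. Uniqueness of sizes identifies the filtered lists behind
  -- `row` and `column` with the given enumerations of sizes `k` and `l`.
  enumeration-double-counting :
    (∀ x y → Dec (R x y)) → ∀ {n m k l} → Enumeration P n → Enumeration Q m →
    (∀ x → x ∈ P → Enumeration (λ y → y ∈ Q × R x y) k) →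
    (∀ y → y ∈ Q → Enumeration (λ x → x ∈ P × R x y) l) → n * k ≡ m * l
  enumeration-double-counting R? {n} {m} {k} {l} E E′ rows columns = begin
    n * k                                    ≡⟨ cong (_* k) (size E) ⟨
    length (list E) * k                      ≡⟨ sum-constant (All.tabulate row≡) ⟨
    sum (map (row R? (list E′)) (list E))    ≡⟨ double-counting R? (list E) (list E′) ⟩
    sum (map (column R? (list E)) (list E′)) ≡⟨ sum-constant (All.tabulate column≡) ⟩
    length (list E′) * l                     ≡⟨ cong (_* l) (size E′) ⟩
    m * l                                    ∎
    where
    open ≡-Reasoning
    row≡ : ∀ {x} → x ∈ˡ list E → row R? (list E′) x ≡ k
    row≡ {x} x∈ = enumeration-unique (enumeration-filter (R? x) E′) (rows x (sound E x∈))
    column≡ : ∀ {y} → y ∈ˡ list E′ → column R? (list E) y ≡ l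
    column≡ {y} y∈ = enumeration-unique (enumeration-filter (λ x → R? x y) E) (columns y (sound E′ y∈))

  -- Concatenating the finitely many columns reaches every element of `P`; repetitions are removed
  -- afterwards by `enumeration-cover`.
  enumeration-union :
    DecidableEquality A → Decidable P → ∀ {m l} → Enumeration Q m →
    (∀ y → y ∈ Q → Enumeration (λ x → x ∈ P × R x y) l) →
    (∀ x → x ∈ P → ∃[ y ] (y ∈ Q × R x y)) → ∃[ n ] Enumeration P n
  enumeration-union _≟_ P? E columns covered =
    let xs , covers = cover (list E) (sound E)
    in enumeration-cover _≟_ P? xs λ {x} Px →
         let y , Qy , Rxy = covered x Px in covers y (complete E Qy) Px Rxy
    where
    cover : ∀ ys → (∀ {y} → y ∈ˡ ys → y ∈ Q) →
            ∃[ xs ] (∀ y → y ∈ˡ ys → ∀ {x} → x ∈ P → R x y → x ∈ˡ xs)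
    cover []       _    = [] , λ _ ()
    cover (y ∷ ys) ys⊆Q with cover ys (ys⊆Q ∘ there) | columns y (ys⊆Q (here refl))
    ... | xs , covers | E₁ = list E₁ ++ xs , λ where
      .y (here refl) Px Rxy → ∈-++⁺ˡ (complete E₁ (Px , Rxy))
      z  (there z∈)  Px Rxz → ∈-++⁺ʳ (list E₁) (covers z z∈ Px Rxz)

-- Self-similar graphs: cells, boundaries and walks.

module SelfSimilarity
  {v e f} (em : ExcludedMiddle (v ⊔ e ⊔ f)) (X : Graph v e) (F : Pred (Graph.Vertex X) f)
  (ψ : Graph.Vertex X → [ x ∈ Graph.Vertex X ∣ F x ]) (selfSimilar : SelfSimilar X F ψ) where

  open Graph X
  open SelfSimilar selfSimilar
  open IsIsomorphism F3

  V : Set v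
  V = Vertex

  ⟪_⟫ : Cell X F → Pred V (v ⊔ e ⊔ f)
  ⟪_⟫ = ⟦_⟧ X F

  emᵛ : ExcludedMiddle v
  emᵛ = excludedMiddle-lower v (e ⊔ f) em

  emᵉ : ExcludedMiddle e
  emᵉ = excludedMiddle-lower e (v ⊔ f) em

  emᵛᵉ : ExcludedMiddle (v ⊔ e)
  emᵛᵉ = excludedMiddle-lower (v ⊔ e) f em

  _≟_ : DecidableEquality V
  x ≟ y = emᵛ

  F? : Decidable F
  F? x = excludedMiddle-lower f (v ⊔ e) em

  p : V → V
  p x = value (ψ x)

  p∈F : ∀ x → p x ∈ F
  p∈F x = proof-of F? (ψ x)

  p-injective : Injective _≡_ _≡_ p
  p-injective eq = proj₁ bijective (value-injective eq)

  p-surjective : ∀ {x} → x ∈ F → ∃[ y ] x ≡ p y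
  p-surjective Fx = let y , eq = proj₂ bijective (_ , [ Fx ]) in y , sym (cong value (eq refl))

  cell-disjoint-F : ∀ C {x} → x ∈ ⟪ C ⟫ → x ∉ F
  cell-disjoint-F C ((x , [ x∉F ]) , _ , refl) Fx = ⊥-elim-irr (x∉F Fx)

  own-cell : ∀ {x} (x∉F : x ∉ F) → x ∈ ⟪ x , [ x∉F ] ⟫
  own-cell x∉F = _ , ε , refl

  cell-extend : ∀ C {x y} → x ∈ ⟪ C ⟫ → x ~ y → y ∉ F → y ∈ ⟪ C ⟫
  cell-extend C (_ , path , refl) x~y y∉F = (_ , [ y∉F ]) , path ◅◅ (x~y ◅ ε) , refl

  cells-meet-⊆ : ∀ C D {x} → x ∈ ⟪ C ⟫ → x ∈ ⟪ D ⟫ → ⟪ C ⟫ ⊆ ⟪ D ⟫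
  cells-meet-⊆ C D ((x , [ _ ]) , C⋯x , refl) ((.x , [ _ ]) , D⋯x , refl) (z , C⋯z , z≡) =
    z , D⋯x ◅◅ reverse ~-sym C⋯x ◅◅ C⋯z , z≡

  -- A boundary vertex outside `F` would be reachable from `C` within the complement of `F`, and so
  -- would lie in `C`.
  θ-⊆F : ∀ C {x} → x ∈ θ X ⟪ C ⟫ → x ∈ F
  θ-⊆F C {x} (x∉C , y , y∈C , x~y) with F? x
  ... | yes Fx = Fx
  ... | no x∉F = contradiction (cell-extend C y∈C (~-sym x~y) x∉F) x∉C

  ∈-θ : ∀ C {x y} → x ∈ F → y ∈ ⟪ C ⟫ → x ~ y → x ∈ θ X ⟪ C ⟫
  ∈-θ C Fx y∈C x~y = (λ x∈C → cell-disjoint-F C x∈C Fx) , _ , y∈C , x~y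

  -- By (F2) the closures of two different cells cannot share both `x` and `y`.
  θ-determines-cell : ∀ C D {x y} → x ≢ y → x ∈ θ X ⟪ C ⟫ → x ∈ θ X ⟪ D ⟫ →
                      y ∈ θ X ⟪ C ⟫ → y ∈ θ X ⟪ D ⟫ → ⟪ C ⟫ ≐ ⟪ D ⟫
  θ-determines-cell C D x≢y x∈C x∈D y∈C y∈D with em {⟪ C ⟫ ≐ ⟪ D ⟫}
  ... | yes C≐D = C≐D
  ... | no  C≭D = contradiction (F2 C D C≭D _ _ (inj₂ x∈C) (inj₂ x∈D) (inj₂ y∈C) (inj₂ y∈D)) x≢y

  p-adjacent⇒ : ∀ {x y} → x ~ y → ∃[ C ] (p x ∈ θ X ⟪ C ⟫ × p y ∈ θ X ⟪ C ⟫)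
  p-adjacent⇒ {x} {y} x~y = proj₂ (Equivalence.to (adjacency x y) x~y)

  p-adjacent⇐ : ∀ C {x y} → x ≢ y → p x ∈ θ X ⟪ C ⟫ → p y ∈ θ X ⟪ C ⟫ → x ~ y
  p-adjacent⇐ C {x} {y} x≢y px∈ py∈ =
    Equivalence.from (adjacency x y) ((λ eq → x≢y (proj₁ bijective eq)) , C , px∈ , py∈)

  -- Vertices of F are pairwise non-adjacent, so between consecutive visits to F a walk
  -- spends at least two steps inside one cell, and this becomes one step of the reduced graph.
  walk-contract : ∀ {n a b x y} → Walk X n a b → a ≡ p x → b ≡ p y →
                  ∃[ m ] (m + m ≤ n × Walk X m x y)
  -- Here `p x` is the last vertex of `F` visited, and the walk is what remains after entering `C`
  -- from it; the `suc` in the bound accounts for that entering step.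
  walk-contract-cell : ∀ C {n a b x y} → Walk X n a b → a ∈ ⟪ C ⟫ → p x ∈ θ X ⟪ C ⟫ → b ≡ p y →
                       ∃[ m ] (m + m ≤ suc n × Walk X m x y)

  walk-contract {x = x} [] a≡ b≡ =
    0 , z≤n , subst (Walk X 0 x) (p-injective (trans (sym a≡) b≡)) []
  walk-contract {x = x} (a~c ∷ w) refl b≡ =
    walk-contract-cell _ w (own-cell c∉F) (∈-θ _ (p∈F x) (own-cell c∉F) a~c) b≡
    where c∉F = λ Fc → F1 _ _ (p∈F x) Fc a~c

  walk-contract-cell C [] a∈C _ refl = contradiction (p∈F _) (cell-disjoint-F C a∈C)
  walk-contract-cell C {x = x} (_∷_ {y = c} a~c w) a∈C px∈ b≡ with F? c
  ... | no c∉F =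
    let m , m+m≤ , w′ = walk-contract-cell C w (cell-extend C a∈C a~c c∉F) px∈ b≡
    in m , m≤n⇒m≤1+n m+m≤ , w′
  ... | yes Fc with p-surjective Fc
  ...   | z , refl with walk-contract w refl b≡ | x ≟ z
  -- The excursion returns to the vertex of `F` from which it started, so it contributes no step to
  -- the contracted walk.
  ...     | m , m+m≤ , w′ | yes refl = m , m≤n⇒m≤1+n (m≤n⇒m≤1+n m+m≤) , w′
  ...     | m , m+m≤ , w′ | no x≢z   =
    suc m , s≤s (≤-trans (≤-reflexive (+-suc m m)) (s≤s m+m≤))
    , p-adjacent⇐ C x≢z px∈ (∈-θ C Fc a∈C (~-sym a~c)) ∷ w′

  -- Each contraction removes one application of `p` from both ends and at least halves the length.
  -- A length of at most `k` thus drops to 0 within `k` rounds.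
  walk-between-iterates : ∀ k {n a b x y} → n ≤ k → Walk X n a b →
                          a ≡ fold x p k → b ≡ fold y p k → a ≡ b
  walk-between-iterates zero    z≤n [] _ _ = refl
  walk-between-iterates (suc k) n≤ w refl refl =
    let m , m+m≤n , w′ = walk-contract w refl refl
    in cong p (walk-between-iterates k (halve m (≤-trans m+m≤n n≤)) w′ refl refl)
    where
    halve : ∀ m → m + m ≤ suc k → m ≤ k
    halve zero    _          = z≤n
    halve (suc m) (s≤s m+m≤) = ≤-trans (m≤n+m (suc m) m) m+m≤

  -- Vertices in all iterated images, and induction along ψ.

  Deep : Pred V v
  Deep x = ∀ k → ∃[ y ] x ≡ fold y p k

  deep-p : ∀ {x} → Deep x → Deep (p x)
  deep-p _    zero    = _ , refl
  deep-p deep (suc k) = let y , x≡ = deep k in y , cong p x≡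

  origin⇒deep : ∀ {o} → IsOrigin X F ψ o → Deep o
  origin⇒deep {o} po≡o k = o , fixed k
    where
    fixed : ∀ k → o ≡ fold o p k
    fixed zero    = refl
    fixed (suc k) = trans (sym po≡o) (cong p (fixed k))

  star⇒walk : ∀ {x y} → Star _~_ x y → ∃[ n ] Walk X n x y
  star⇒walk ε            = 0 , []
  star⇒walk (x~y ◅ path) = let n , w = star⇒walk path in suc n , x~y ∷ w

  module _ (connected : Connected X) where

    deep-unique : ∀ {x y} → Deep x → Deep y → x ≡ y
    deep-unique {x} {y} dx dy =
      let n , w = star⇒walk (connected x y)
      -- The depth used is the length of a walk joining the two vertices.
      in walk-between-iterates n ≤-refl w (proj₂ (dx n)) (proj₂ (dy n))

    origin-unique : ∀ {o o′} → IsOrigin X F ψ o → IsOrigin X F ψ o′ → o ≡ o′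
    origin-unique o-origin o′-origin = deep-unique (origin⇒deep o-origin) (origin⇒deep o′-origin)

    -- If `x` is missing from the image of some iterate of `p`, taking preimages reaches a vertex
    -- outside `F` after finitely many steps. Otherwise `x` is deep; then so is `p x`, and
    -- uniqueness makes `x` an origin.
    p-induction : (Q : Pred V ℓ) → (∀ {x} → IsOrigin X F ψ x → x ∈ Q) → (∀ {x} → x ∉ F → x ∈ Q) →
                  (∀ {x} → x ∈ Q → p x ∈ Q) → ∀ x → x ∈ Q
    p-induction Q origin outside step x with emᵛ {∃[ k ] ¬ (∃[ y ] x ≡ fold y p k)}
    ... | yes (k , shallow) = shallow-∈ k shallow
      where
      shallow-∈ : ∀ k {x} → ¬ (∃[ y ] x ≡ fold y p k) → x ∈ Q
      shallow-∈ zero    shallow = contradiction (_ , refl) shallow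
      shallow-∈ (suc k) {x} shallow with F? x
      ... | no x∉F = outside x∉F
      ... | yes Fx with p-surjective Fx
      ...   | _ , refl = step (shallow-∈ k λ (y , x≡) → shallow (y , cong p x≡))
    ... | no ¬shallow = origin (deep-unique (deep-p deep) deep)
      where
      deep : Deep x
      deep k with emᵛ {∃[ y ] x ≡ fold y p k}
      ... | yes image = image
      ... | no ¬image = contradiction (k , ¬image) ¬shallow

-- Homogeneously self-similar graphs: cell sizes and degrees.

module HomogeneousSelfSimilarity
  {v e f} (em : ExcludedMiddle (v ⊔ e ⊔ f)) (X : Graph v e) (connected : Connected X)
  (F : Pred (Graph.Vertex X) f) (ψ : Graph.Vertex X → [ x ∈ Graph.Vertex X ∣ F x ])
  (homogeneous : HomogeneouslySelfSimilar X F ψ) (constantInnerDegree : ConstantInnerDegree X F) where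

  open Graph X
  open HomogeneouslySelfSimilar homogeneous
  open SelfSimilar selfSimilar
  open SelfSimilarity em X F ψ selfSimilar

  private
    b : ℕ
    b = proj₁ constantInnerDegree

  degree⇒ : ∀ {x n} → HasDegree X x n → Enumeration (x ~_) n
  degree⇒ = cardinality⇒ (λ _ → emᵉ)

  degree⇐ : ∀ {x n} → Enumeration (x ~_) n → HasDegree X x n
  degree⇐ = cardinality⇐ _≟_

  -- The inner degree counts neighbours in the whole closure of `C`, but by (F1) none of them lies
  -- on the boundary.
  inner-neighbours : ∀ C {x} → x ∈ θ X ⟪ C ⟫ → Enumeration (λ y → y ∈ ⟪ C ⟫ × x ~ y) b
  inner-neighbours C {x} x∈θ = enumeration-resp into onto
    (enumeration-image value-injective
      (cardinality⇒ (λ _ → emᵉ) (proj₂ constantInnerDegree C (x , [ inj₂ x∈θ ]) x∈θ)))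
    where
    into : image value (λ y → x ~ value y) ⊆ (λ y → y ∈ ⟪ C ⟫ × x ~ y)
    into (y , x~y , refl) with proof-of (λ _ → em) y
    ... | inj₁ y∈C = y∈C , x~y
    ... | inj₂ y∈θ = contradiction x~y (F1 _ _ (θ-⊆F C x∈θ) (θ-⊆F C y∈θ))
    onto : (λ y → y ∈ ⟪ C ⟫ × x ~ y) ⊆ image value (λ y → x ~ value y)
    onto (y∈C , x~y) = (_ , [ inj₁ y∈C ]) , x~y , refl

  module _ (C₀ : Cell X F) where

    private
      cell₀-enumeration : Enumeration {A = Graph.Vertex (cellGraph X F C₀)} U (proj₁ (H1-finite C₀))
      cell₀-enumeration = enumeration-U (proj₂ (H1-finite C₀))

    -- Finiteness gives each cell a size of its own; the isomorphisms of (H1) from the reference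
    -- cell `C₀` make the size common to all.
    closure-size : ∃[ m ] (∀ C → Enumeration (closure X ⟪ C ⟫) m)
    closure-size = _ , λ C →
      let α , α-iso , _ = H1-iso C₀ C
          α-inj , α-surj = IsIsomorphism.bijective α-iso
      in enumeration-resp
           (λ { (x , _ , refl) → proof-of (λ _ → em) (α x) })
           (λ x∈ → let y , αy≡x = α-surj (_ , [ x∈ ]) in y , _ , cong value (αy≡x refl))
           (enumeration-image (α-inj ∘ value-injective) cell₀-enumeration)

    boundary-size : ∃[ t ] (∀ C → Enumeration (θ X ⟪ C ⟫) t)
    boundary-size =
      let t , _ , E = enumeration-sub (λ _ → em) (λ _ → _) cell₀-enumeration
      in t , λ C →
        let α , α-iso , αθ⊆θ , θ⊆αθ = H1-iso C₀ C
        in enumeration-resp αθ⊆θ θ⊆αθ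
             (enumeration-image (proj₁ (IsIsomorphism.bijective α-iso) ∘ value-injective) E)

  -- All neighbours of `x` lie in the closure of the cell of `x`.
  degree-outside-F : ∀ {m x} → (∀ C → Enumeration (closure X ⟪ C ⟫) m) → x ∉ F →
                     ∃[ n ] (n ≤ m × Enumeration (x ~_) n)
  degree-outside-F closures x∉F = enumeration-sub (λ _ → emᵉ) neighbours⊆ (closures C)
    where
    C = _ , [ x∉F ]
    neighbours⊆ : (_ ~_) ⊆ closure X ⟪ C ⟫
    neighbours⊆ {y} x~y with F? y
    ... | yes Fy = inj₂ (∈-θ C Fy (own-cell x∉F) (~-sym x~y))
    ... | no y∉F = inj₁ (cell-extend C (own-cell x∉F) x~y y∉F)

  -- The incidence relation for the double count around `p x`: `u` will be a neighbour of `p x` in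
  -- `X`, and `w` a neighbour of `p x` in the reduced graph.
  Joined : V → V → Set (v ⊔ e ⊔ f)
  Joined u w = ∃[ C ] (u ∈ ⟪ C ⟫ × w ∈ θ X ⟪ C ⟫)

  -- By (F2) only one cell has both `p x` and `w` on its boundary, so the vertices counted are the
  -- inner neighbours of `p x` in that cell.
  joined-neighbours : ∀ x w → w ∈ image p (x ~_) → Enumeration (λ u → p x ~ u × Joined u w) b
  joined-neighbours x _ (y , x~y , refl) with p-adjacent⇒ x~y
  ... | C , px∈ , py∈ = enumeration-resp
    (λ (u∈C , px~u) → px~u , C , u∈C , py∈)
    (λ (px~u , D , u∈D , py∈D) →
      proj₂ (θ-determines-cell C D (λ eq → ~-irrefl (p-injective eq) x~y)
               px∈ (∈-θ D (p∈F x) u∈D px~u) py∈ py∈D) u∈D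
      , px~u)
    (inner-neighbours C px∈)

  -- The boundary size has the form `suc (suc s)` so that `suc s`, the number of other boundary
  -- vertices, is visibly nonzero: it is cancelled below, and a member is chosen from a set of that
  -- size.
  module _ {s} (boundaries : ∀ C → Enumeration (θ X ⟪ C ⟫) (suc (suc s))) where

    other-boundary-vertices : ∀ C {x} → x ∈ θ X ⟪ C ⟫ → Enumeration (λ w → w ∈ θ X ⟪ C ⟫ × w ≢ x) (suc s)
    other-boundary-vertices C x∈θ with enumeration-remove _≟_ x∈θ (boundaries C)
    ... | _ , refl , E = E

    -- By (F1) `u` lies in a cell, which is unique and has `p x` on its boundary. By (F3) the other
    -- boundary vertices of this cell are images of neighbours of `x`.
    joined-images : ∀ x u → p x ~ u → Enumeration (λ w → w ∈ image p (x ~_) × Joined u w) (suc s)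
    joined-images x u px~u = enumeration-resp into onto (other-boundary-vertices C px∈)
      where
      u∉F : u ∉ F
      u∉F Fu = F1 _ _ (p∈F x) Fu px~u
      C = u , [ u∉F ]
      px∈ = ∈-θ C (p∈F x) (own-cell u∉F) px~u
      into : (λ w → w ∈ θ X ⟪ C ⟫ × w ≢ p x) ⊆ (λ w → w ∈ image p (x ~_) × Joined u w)
      into (w∈θ , w≢px) with p-surjective (θ-⊆F C w∈θ)
      ... | y , refl = (y , p-adjacent⇐ C (w≢px ∘ cong p ∘ sym) px∈ w∈θ , refl) , C , own-cell u∉F , w∈θ
      onto : (λ w → w ∈ image p (x ~_) × Joined u w) ⊆ (λ w → w ∈ θ X ⟪ C ⟫ × w ≢ p x)
      onto ((y , x~y , refl) , D , u∈D , (w∉D , z , z∈D , w~z)) =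
        ∈-θ C (p∈F y) (cells-meet-⊆ D C u∈D (own-cell u∉F) z∈D) w~z
        , λ eq → ~-irrefl (sym (p-injective eq)) x~y

    degree-p : ∀ {x n m} → Enumeration (x ~_) n → Enumeration (p x ~_) m → m * suc s ≡ n * b
    degree-p {x} E E′ = enumeration-double-counting (λ _ _ → em)
      E′ (enumeration-image p-injective E) (joined-images x) (joined-neighbours x)

    -- Each of the `n` images of neighbours of `x` is joined to only `b` neighbours of `p x`, and
    -- every neighbour of `p x` is joined to one of these images.
    degree-p-finite : ∀ {x n} → Enumeration (x ~_) n → ∃[ m ] Enumeration (p x ~_) m
    degree-p-finite {x} E = enumeration-union _≟_ (λ _ → emᵉ)
      (enumeration-image p-injective E) (joined-neighbours x)
      (λ u px~u → enumeration-member (joined-images x u px~u))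

    no-origin⇒locallyFinite : ¬ (∃[ o ] IsOrigin X F ψ o) →
                              ∀ {m} → (∀ C → Enumeration (closure X ⟪ C ⟫) m) → LocallyFinite X
    no-origin⇒locallyFinite no-origin closures x =
      let n , E = p-induction connected (λ x → ∃[ n ] Enumeration (x ~_) n)
            (λ o-origin → contradiction (_ , o-origin) no-origin)
            (λ x∉F → let n , _ , E = degree-outside-F closures x∉F in n , E)
            (λ (_ , E) → degree-p-finite E) x
      in n , degree⇐ E

    -- At an origin o, degree-p reads deg o · (s + 1) = deg o · b, so s + 1 = b.
    origin∧locallyFinite⇒bounded : ∀ {o o′} → IsOrigin X F ψ o → o ~ o′ → LocallyFinite X →
                                   ∀ {m} → (∀ C → Enumeration (closure X ⟪ C ⟫) m) → BoundedGeometry X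
    origin∧locallyFinite⇒bounded {o} po≡o o~o′ locallyFinite {m} closures
      with d , deg-o ← locallyFinite o
      with E ← degree⇒ deg-o
      -- The neighbour `o′` shows that the degree `d` of `o` is a successor, so it may be cancelled
      -- next.
      with _ , refl , _ ← enumeration-remove _≟_ o~o′ E
      with s+1≡b ← *-cancelˡ-≡ (suc s) b d (degree-p E (subst (λ x → Enumeration (x ~_) d) (sym po≡o) E))
      -- `m` bounds the degrees outside `F`, `d` is the degree of the only origin, and `p` preserves
      -- degrees because `suc s` equals `b`.
      = m ⊔ⁿ d , λ x →
        let n , n≤ , E = p-induction connected (λ x → ∃[ n ] (n ≤ m ⊔ⁿ d × Enumeration (x ~_) n))
              (λ x-origin → d , m≤n⊔m m d
                 , subst (λ x → Enumeration (x ~_) d) (origin-unique connected po≡o x-origin) E)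
              (λ x∉F →
                let n , n≤m , E = degree-outside-F closures x∉F
                in n , ≤-trans n≤m (m≤m⊔n m d) , E)
              (λ (n , n≤ , E) →
                 let n′ , E′ = degree-p-finite E
                     n′≡n = *-cancelʳ-≡ n′ n (suc s) (trans (degree-p E E′) (cong (n *_) (sym s+1≡b)))
                 in n′ , ≤-trans (≤-reflexive n′≡n) n≤ , E′)
              x
        in n , n≤ , degree⇐ E

  -- Boundary size at least two, and the case distinction.

  neighbour-exists : ∀ {x y} → x ~ y → ∀ z → ∃[ w ] z ~ w
  neighbour-exists {x} x~y z with connected z x
  ... | ε       = _ , x~y
  ... | z~w ◅ _ = _ , z~w

  boundary-size≥2 : ∀ C {x y t} → x ≢ y → x ∈ θ X ⟪ C ⟫ → y ∈ θ X ⟪ C ⟫ → Enumeration (θ X ⟪ C ⟫) t →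
                    ∃[ s ] t ≡ suc (suc s)
  boundary-size≥2 C x≢y x∈θ y∈θ E with enumeration-remove _≟_ x∈θ E
  ... | _ , refl , E₁ with enumeration-remove _≟_ (y∈θ , x≢y ∘ sym) E₁
  ...   | s , refl , _ = s , refl

  edgeless⇒bounded : ¬ (∃[ x ] ∃[ y ] x ~ y) → BoundedGeometry X
  edgeless⇒bounded edgeless = 0 , λ x → 0 , z≤n , degree⇐ (record
    { list     = []
    ; unique   = []
    ; sound    = λ ()
    ; complete = λ x~y → contradiction (_ , _ , x~y) edgeless
    ; size     = refl
    })

  trichotomy : BoundedGeometry X
    ⊎ (¬ (∃[ o ] IsOrigin X F ψ o) × LocallyFinite X × ¬ BoundedGeometry X)
    ⊎ ((∃[ o ] IsOrigin X F ψ o) × ¬ LocallyFinite X)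
  trichotomy with emᵛᵉ {BoundedGeometry X} | emᵛᵉ {∃[ x ] ∃[ y ] x ~ y}
  ... | yes bounded   | _            = inj₁ bounded
  ... | no  _         | no  edgeless = inj₁ (edgeless⇒bounded edgeless)
  ... | no  unbounded | yes (x , y , x~y)
      -- The edge yields a cell with the distinct vertices `p x` and `p y` on its boundary; this
      -- cell is the reference cell and shows that the common boundary size is at least two.
      with C , px∈ , py∈ ← p-adjacent⇒ x~y
      with m , closures ← closure-size C | t , boundaries ← boundary-size C
      with s , refl ← boundary-size≥2 C (λ eq → ~-irrefl (p-injective eq) x~y) px∈ py∈ (boundaries C)
      with emᵛ {∃[ o ] IsOrigin X F ψ o}
  ...   | no  no-origin      =
    inj₂ (inj₁ (no-origin , no-origin⇒locallyFinite boundaries no-origin closures , unbounded))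
  ...   | yes (o , o-origin) =
    inj₂ (inj₂ ((o , o-origin) , λ locallyFinite → unbounded
      (origin∧locallyFinite⇒bounded boundaries o-origin (proj₂ (neighbour-exists x~y o))
        locallyFinite closures)))

corollary1 : ∀ {v e f : Level} → ExcludedMiddle (v ⊔ e ⊔ f) →
    (X : Graph v e) → Connected X → ¬ Finite (Graph.Vertex X) →
    (F : Pred (Graph.Vertex X) f) (ψ : Graph.Vertex X → [ x ∈ Graph.Vertex X ∣ F x ]) →
    HomogeneouslySelfSimilar X F ψ → ConstantInnerDegree X F →
    BoundedGeometry X
    ⊎ (¬ (∃[ o ] IsOrigin X F ψ o) × LocallyFinite X × ¬ BoundedGeometry X)
    ⊎ ((∃[ o ] IsOrigin X F ψ o) × ¬ LocallyFinite X)
corollary1 em X connected _ F ψ = HomogeneousSelfSimilarity.trichotomy em X connected F ψ
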